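{- For every first-order signature $\Sigma$ and every formula $\varphi$ over $\Sigma$: <ul> <li>$\mathsf{FSAT}(\Sigma)\,\varphi\leftrightarrow\mathsf{FSAT}'(\Sigma)\,\varphi$;</li> <li>consequently, $\mathsf{FSAT}(\Sigma)\preceq\mathsf{FSAT}'(\Sigma)$ and $\mathsf{FSAT}'(\Sigma)\preceq\mathsf{FSAT}(\Sigma)$.</li> </ul>
   Context: We work in constructive type theory. $p\preceq q$ means there is a function $f$ with $p\,x\leftrightarrow q(f\,x)$ for all $x$. A type is finite if some list contains all of its elements, and discrete if its equality is decidable. A signature consists of a type of function symbols and a type of relation symbols, each with an arity. Formulas are first-order formulas built from $\dot\bot$, atoms, $\dot\to,\dot\land,\dot\lor,\dot\forall,\dot\exists$. A model over a domain $D$ interprets function symbols as functions $D^{|f|}\to D$ and relation symbols as predicates $D^{|P|}\to\mathbb P$, with Tarski satisfaction $\mathcal M\vDash_\rho\varphi$. The model is decidable if every relation interpretation is decidable. $\mathsf{FSAT}(\Sigma)\,\varphi$ holds iff there exist a finite type $D$, a decidable model over $D$ and an assignment $\rho$ satisfying $\varphi$. $\mathsf{FSAT}'(\Sigma)\,\varphi$ is the same but additionally requires $D$ to be discrete. -}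

module Defs where

open import Data.Empty.Polymorphic using (⊥)
open import Data.Irrelevant using (Irrelevant)
open import Data.List using (List)
open import Data.List.Membership.Propositional using (_∈_)
open import Data.Nat using (ℕ; zero; suc)
open import Data.Product using (Σ-syntax; ∃-syntax; _×_)
open import Data.Sum using (_⊎_)
open import Data.Vec using (Vec; []; _∷_)
open import Function using (_⇔_)
open import Level using (Level; _⊔_) renaming (suc to lsuc)
open import Relation.Binary.Definitions using (DecidableEquality)
open import Relation.Unary using (Pred; Decidable)

private
  variable
    a b p q f r : Level

infix 4 _⪯_

_⪯_ : {X : Set a} {Y : Set b} → Pred X p → Pred Y q → Set (a ⊔ b ⊔ p ⊔ q)
_⪯_ {X = X} {Y = Y} P Q = Σ[ g ∈ (X → Y) ] (∀ x → P x ⇔ Q (g x))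

-- Membership is wrapped as a proof-irrelevant proposition: a bare proof of
-- x ∈ xs carries a position in xs, and a choice of positions for all x would
-- already decide equality on A, so that Finite A would imply Discrete A.
Finite : Set a → Set a
Finite A = Σ[ xs ∈ List A ] (∀ x → Irrelevant (x ∈ xs))

Discrete : Set a → Set a
Discrete A = DecidableEquality A

record Signature f r : Set (lsuc (f ⊔ r)) where
  field
    Func   : Set f
    Rel    : Set r
    arityᶠ : Func → ℕ
    arityʳ : Rel → ℕ

open Signature public

module _ (S : Signature f r) where

  -- Variables are de Bruijn indices; index 0 refers to the innermost quantifier.
  data Term : Set f where
    var : ℕ → Term
    fun : (g : Func S) → Vec Term (arityᶠ S g) → Term

  data Formula : Set (f ⊔ r) where
    ⊥̇           : Formula
    atom        : (P : Rel S) → Vec Term (arityʳ S P) → Formula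
    _→̇_ _∧̇_ _∨̇_ : Formula → Formula → Formula
    ∀̇_ ∃̇_       : Formula → Formula

  -- ℙ is read as Set ℓ, the universe of the domain.
  record Model {ℓ} (D : Set ℓ) : Set (f ⊔ r ⊔ lsuc ℓ) where
    field
      funᴹ : (g : Func S) → Vec D (arityᶠ S g) → D
      relᴹ : (P : Rel S) → Pred (Vec D (arityʳ S P)) ℓ

  open Model public

module _ {S : Signature f r} {ℓ} {D : Set ℓ} where

  DecidableModel : Model S D → Set (r ⊔ ℓ)
  DecidableModel M = ∀ P → Decidable (relᴹ M P)

  infixr 5 _·_

  _·_ : D → (ℕ → D) → (ℕ → D)
  (d · ρ) zero    = d
  (d · ρ) (suc n) = ρ n

  module _ (M : Model S D) where

    mutual
      eval : (ℕ → D) → Term S → D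
      eval ρ (var n)    = ρ n
      eval ρ (fun g ts) = funᴹ M g (evals ρ ts)

      evals : ∀ {n} → (ℕ → D) → Vec (Term S) n → Vec D n
      evals ρ []       = []
      evals ρ (t ∷ ts) = eval ρ t ∷ evals ρ ts

  infix 4 _⊨[_]_

  _⊨[_]_ : Model S D → (ℕ → D) → Formula S → Set ℓ
  M ⊨[ ρ ] ⊥̇         = ⊥
  M ⊨[ ρ ] atom P ts = relᴹ M P (evals M ρ ts)
  M ⊨[ ρ ] (φ →̇ ψ)   = M ⊨[ ρ ] φ → M ⊨[ ρ ] ψ
  M ⊨[ ρ ] (φ ∧̇ ψ)   = (M ⊨[ ρ ] φ) × (M ⊨[ ρ ] ψ)
  M ⊨[ ρ ] (φ ∨̇ ψ)   = (M ⊨[ ρ ] φ) ⊎ (M ⊨[ ρ ] ψ)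
  M ⊨[ ρ ] (∀̇ φ)     = ∀ d → M ⊨[ d · ρ ] φ
  M ⊨[ ρ ] (∃̇ φ)     = ∃[ d ] M ⊨[ d · ρ ] φ

-- ℓ is the universe over which domains range.
module _ (ℓ : Level) (S : Signature f r) where

  FSAT : Pred (Formula S) (f ⊔ r ⊔ lsuc ℓ)
  FSAT φ = Σ[ D ∈ Set ℓ ] Σ[ M ∈ Model S D ] Σ[ ρ ∈ (ℕ → D) ]
    Finite D × DecidableModel M × (M ⊨[ ρ ] φ)

  FSAT′ : Pred (Formula S) (f ⊔ r ⊔ lsuc ℓ)
  FSAT′ φ = Σ[ D ∈ Set ℓ ] Σ[ M ∈ Model S D ] Σ[ ρ ∈ (ℕ → D) ]
    Finite D × Discrete D × DecidableModel M × (M ⊨[ ρ ] φ)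

{-# OPTIONS --safe #-}

-- A satisfying model M over D, listed by xs, is replaced by one over the
-- positions of xs. Interpreting a function symbol there requires choosing a
-- position for a value of M, which is impossible up to equality as D need not
-- be discrete. It suffices to choose it up to a decidable congruence for the
-- finitely many symbols of φ. Such a congruence arises from refining the
-- equivalence "no relation symbol of φ distinguishes x and y": each proper
-- refinement discards one of the finitely many pairs of elements, so the
-- process stabilises. Satisfaction of φ is preserved up to the congruence, so
-- distinct positions may represent the same element and no quotient is formed.
module Submission where

open import Data.Fin using (Fin; zero; suc)
import Data.Fin.Properties as Fin
open import Data.Irrelevant as Irrelevant using (Irrelevant; [_])
open import Data.List using (List; []; _∷_; _++_; length; lookup; map; filter; allFin; cartesianProduct)
open import Data.List.Membership.Propositional using (_∈_)
open import Data.List.Membership.Propositional.Properties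
  using (∈-map⁺; ∈-filter⁺; ∈-cartesianProduct⁺; ∈-allFin)
open import Data.List.Properties using (filter-notAll)
open import Data.List.Relation.Unary.All as All using (All; []; _∷_)
open import Data.List.Relation.Unary.All.Properties using (¬All⇒Any¬; ++⁻ˡ; ++⁻ʳ)
open import Data.List.Relation.Unary.Any as Any using (Any)
open import Data.List.Relation.Unary.Any.Properties using (lookup-index)
open import Data.Nat using (ℕ; zero; suc; _<_)
open import Data.Nat.Induction using (<-wellFounded)
open import Data.Product using (∃-syntax; _×_; _,_; proj₁; proj₂; uncurry)
open import Data.Product.Function.NonDependent.Propositional using (_×-⇔_)
open import Data.Sum.Function.Propositional using (_⊎-⇔_)
open import Data.Vec as Vec using (Vec; []; _∷_; _[_]≔_)
open import Data.Vec.Relation.Binary.Pointwise.Inductive using (Pointwise; []; _∷_)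
open import Function using (_⇔_; mk⇔; Equivalence; _∘_; _on_; id)
open import Function.Construct.Identity using (⇔-id)
open import Function.Construct.Symmetry using (⇔-sym)
open import Function.Properties.Equivalence using (⇔-isEquivalence)
open import Function.Related.TypeIsomorphisms using (→-cong-⇔)
open import Induction.WellFounded using (Acc; acc)
open import Level using (Level; Lift; lift; lower; _⊔_)
open import Relation.Binary using (_⇒_; Reflexive; Transitive; IsEquivalence; IsDecEquivalence) renaming (Rel to BinRel)
import Relation.Binary.Construct.Intersection as Intersection
import Relation.Binary.Construct.On as On
open import Relation.Binary.PropositionalEquality using (cong; sym)
open import Relation.Nullary using (Dec; yes; no; map′; recompute; _×-dec_; _→-dec_)
open import Relation.Unary using (Pred; Decidable)
open import Defs

private
  variable
    a f i p r ρ ℓ : Level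
    A D : Set a

-- Decidable quantification over finite types

-- Decidability turns the irrelevant membership proofs of Finite into actual ones.
Finite⇒∀? : {P : Pred A p} → Finite A → Decidable P → Dec (∀ x → P x)
Finite⇒∀? (xs , ∈xs) P? = map′
  (λ all x → let [ x∈xs ] = ∈xs x in recompute (P? x) (All.lookup all x∈xs))
  (λ ∀P → All.universal ∀P xs)
  (All.all? P? xs)

Finite⇒∀Vec? : {n : ℕ} {P : Pred (Vec A n) p} → Finite A → Decidable P → Dec (∀ v → P v)
Finite⇒∀Vec? {n = zero}  fin P? = map′ (λ { p [] → p }) (λ ∀P → ∀P []) (P? [])
Finite⇒∀Vec? {n = suc n} fin P? = map′
  (λ { ∀P (x ∷ v) → ∀P x v })
  (λ ∀P x v → ∀P (x ∷ v))
  (Finite⇒∀? fin λ x → Finite⇒∀Vec? fin λ v → P? (x ∷ v))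

-- Refining a decidable equivalence until it is stable

module Refinement {D : Set a} (fin : Finite D)
  (step : BinRel D ρ → BinRel D ρ)
  (step-isDecEquivalence : ∀ {R} → IsDecEquivalence R → IsDecEquivalence (step R))
  where

  private
    step? : ∀ {R} → IsDecEquivalence R → Decidable (uncurry (step R))
    step? R-dec = uncurry (IsDecEquivalence._≟_ (step-isDecEquivalence R-dec))

    -- `ps` covers all pairs in `R`, possibly with others. If `step R` holds throughout `ps`, then
    -- `R` is stable; otherwise filtering by `step R` shortens `ps`. Intersecting with `step R`,
    -- rather than replacing `R` by it, keeps the filtered list a cover.
    refineFrom : (ps : List (D × D)) → Acc _<_ (length ps) →
      (R : BinRel D ρ) → IsDecEquivalence R →
      (∀ x y → R x y → Irrelevant ((x , y) ∈ ps)) →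
      ∃[ R′ ] IsDecEquivalence R′ × (R′ ⇒ R) × (R′ ⇒ step R′)
    refineFrom ps (acc rec) R R-dec R⊆ps with All.all? (step? R-dec) ps
    ... | yes all = R , R-dec , id , λ {x} {y} xRy →
      let [ xy∈ps ] = R⊆ps x y xRy in
      recompute (step? R-dec (x , y)) (All.lookup all xy∈ps)
    ... | no ¬all =
      let S? = step? R-dec
          R′ , R′-dec , R′⇒R∩S , R′⇒step =
            refineFrom (filter S? ps) (rec (filter-notAll S? ps (¬All⇒Any¬ S? ps ¬all)))
              (R Intersection.∩ step R)
              (Intersection.isDecEquivalence R-dec (step-isDecEquivalence R-dec))
              (λ x y (xRy , xSy) → Irrelevant.map (λ xy∈ps → ∈-filter⁺ S? xy∈ps xSy) (R⊆ps x y xRy))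
      in R′ , R′-dec , proj₁ ∘ R′⇒R∩S , R′⇒step

  refine : {R : BinRel D ρ} → IsDecEquivalence R →
    ∃[ R′ ] IsDecEquivalence R′ × (R′ ⇒ R) × (R′ ⇒ step R′)
  refine R-dec = let xs , ∈xs = fin in
    refineFrom (cartesianProduct xs xs) (<-wellFounded _) _ R-dec λ x y _ →
      let [ x∈xs ] = ∈xs x
          [ y∈xs ] = ∈xs y
      in [ ∈-cartesianProduct⁺ x∈xs y∈xs ]

-- Congruence one argument at a time

Interchangeable : {n : ℕ} → BinRel (Vec D n) ℓ → BinRel D _
Interchangeable E x y = ∀ k v → E (v [ k ]≔ x) (v [ k ]≔ y)

Interchangeable-isDecEquivalence : {n : ℕ} {E : BinRel (Vec D n) ℓ} → Finite D →
  IsDecEquivalence E → IsDecEquivalence (Interchangeable E)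
Interchangeable-isDecEquivalence fin E-dec = record
  { isEquivalence = record
    { refl  = λ k v → E.refl
    ; sym   = λ x∼y k v → E.sym (x∼y k v)
    ; trans = λ x∼y y∼z k v → E.trans (x∼y k v) (y∼z k v)
    }
  ; _≟_ = λ x y → Fin.all? λ k → Finite⇒∀Vec? fin λ v → (v [ k ]≔ x) E.≟ (v [ k ]≔ y)
  }
  where module E = IsDecEquivalence E-dec

-- Arguments are exchanged from left to right, one at a time, and transitivity of `E` joins the
-- exchanges.
Interchangeable⇒Pointwise : {n : ℕ} {R : BinRel D ρ} {E : BinRel (Vec D n) ℓ} →
  Reflexive E → Transitive E → R ⇒ Interchangeable E → Pointwise R ⇒ E
Interchangeable⇒Pointwise refl trans R⇒ [] = refl
Interchangeable⇒Pointwise {E = E} refl trans R⇒ (_∷_ {x = x} {y = y} {xs = v} {ys = w} xRy vRw) =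
  trans (R⇒ xRy zero (x ∷ v))
    -- The head is already exchanged, so the induction runs on the tails with `y` fixed in front.
    (Interchangeable⇒Pointwise {E = E on (y ∷_)} refl trans
      (λ x′Ry′ k u → R⇒ x′Ry′ (suc k) (y ∷ u)) vRw)

All-isDecEquivalence : {I : Set i} {R : I → BinRel D ρ} →
  (∀ s → IsDecEquivalence (R s)) → ∀ ss → IsDecEquivalence (λ x y → All (λ s → R s x y) ss)
All-isDecEquivalence R-dec ss = record
  { isEquivalence = record
    { refl  = All.universal (λ s → R.refl s) ss
    ; sym   = All.map (λ {s} → R.sym s)
    ; trans = λ xRy yRz → All.zipWith (λ {s} → uncurry (R.trans s)) (xRy , yRz)
    }
  ; _≟_ = λ x y → All.all? (λ s → R._≟_ s x y) ss
  }
  where module R s = IsDecEquivalence (R-dec s)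

⇔-isDecEquivalence : {P : Pred A p} → Decidable P → IsDecEquivalence (_⇔_ on P)
⇔-isDecEquivalence {P = P} P? = record
  { isEquivalence = On.isEquivalence P ⇔-isEquivalence
  ; _≟_ = λ x y → map′ (uncurry mk⇔) (λ e → Equivalence.to e , Equivalence.from e)
      ((P? x →-dec P? y) ×-dec (P? y →-dec P? x))
  }

-- Symbols occurring in a formula

module _ {S : Signature f r} where

  mutual
    funcsᵗ : Term S → List (Func S)
    funcsᵗ (var n)    = []
    funcsᵗ (fun g ts) = g ∷ funcsᵗˢ ts

    funcsᵗˢ : {n : ℕ} → Vec (Term S) n → List (Func S)
    funcsᵗˢ []       = []
    funcsᵗˢ (t ∷ ts) = funcsᵗ t ++ funcsᵗˢ ts

  funcs : Formula S → List (Func S)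
  funcs ⊥̇           = []
  funcs (atom P ts) = funcsᵗˢ ts
  funcs (φ →̇ ψ)     = funcs φ ++ funcs ψ
  funcs (φ ∧̇ ψ)     = funcs φ ++ funcs ψ
  funcs (φ ∨̇ ψ)     = funcs φ ++ funcs ψ
  funcs (∀̇ φ)       = funcs φ
  funcs (∃̇ φ)       = funcs φ

  rels : Formula S → List (Rel S)
  rels ⊥̇           = []
  rels (atom P ts) = P ∷ []
  rels (φ →̇ ψ)     = rels φ ++ rels ψ
  rels (φ ∧̇ ψ)     = rels φ ++ rels ψ
  rels (φ ∨̇ ψ)     = rels φ ++ rels ψ
  rels (∀̇ φ)       = rels φ
  rels (∃̇ φ)       = rels φ

-- Decidable congruences of a model and transfer along them

module _ {S : Signature f r} {D : Set ℓ} (M : Model S D) where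

  Congᶠ : BinRel D ρ → Func S → Set (ℓ ⊔ ρ)
  Congᶠ R g = Pointwise R ⇒ (R on funᴹ M g)

  Congʳ : BinRel D ρ → Rel S → Set (ℓ ⊔ ρ)
  Congʳ R P = Pointwise R ⇒ (_⇔_ on relᴹ M P)

  -- `Congʳ` mentions `R` only as a hypothesis, so it survives shrinking `R` and is imposed once,
  -- through `base`. `Congᶠ` has `R` on both sides, so it needs a relation stable under `step`.
  decidableCongruence : Finite D → DecidableModel M → (Fs : List (Func S)) (Ps : List (Rel S)) →
    ∃[ R ] IsDecEquivalence {ℓ = f ⊔ r ⊔ ℓ} R × All (Congᶠ R) Fs × All (Congʳ R) Ps
  decidableCongruence fin M? Fs Ps =
    let R , R-dec , R⇒base , R⇒step = refine base-isDecEquivalence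
        module R = IsDecEquivalence R-dec
    in R , R-dec
      , All.tabulate (λ {g} g∈Fs → Interchangeable⇒Pointwise {E = R on funᴹ M g} R.refl R.trans
          λ xRy → All.lookup (R⇒step xRy) g∈Fs)
      , All.tabulate (λ {P} P∈Ps → Interchangeable⇒Pointwise {E = _⇔_ on relᴹ M P} ⇔.refl ⇔.trans
          λ xRy → All.lookup (lower (R⇒base xRy)) P∈Ps)
    where
    step : BinRel D (f ⊔ r ⊔ ℓ) → BinRel D (f ⊔ r ⊔ ℓ)
    step R x y = All (λ g → Interchangeable (R on funᴹ M g) x y) Fs

    base : BinRel D (f ⊔ r ⊔ ℓ)
    -- `step` must map relations to relations of the same level, and its `All` over function symbols
    -- brings in `f`; the lift moves `base` to that level.
    base x y = Lift f (All (λ P → Interchangeable (_⇔_ on relᴹ M P) x y) Ps)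

    module ⇔ {ℓ} = IsEquivalence (⇔-isEquivalence {ℓ})

    step-isDecEquivalence : ∀ {R} → IsDecEquivalence R → IsDecEquivalence (step R)
    step-isDecEquivalence R-dec = All-isDecEquivalence
      (λ g → Interchangeable-isDecEquivalence fin (On.isDecEquivalence (funᴹ M g) R-dec)) Fs

    base-isDecEquivalence : IsDecEquivalence base
    base-isDecEquivalence = record
      { isEquivalence = record
        { refl  = lift B.refl
        ; sym   = λ (lift e) → lift (B.sym e)
        ; trans = λ (lift e) (lift e′) → lift (B.trans e e′)
        }
      ; _≟_ = λ x y → map′ lift lower (x B.≟ y)
      }
      where
      module B = IsDecEquivalence (All-isDecEquivalence
        (λ P → Interchangeable-isDecEquivalence fin (⇔-isDecEquivalence (M? P))) Ps)

    open Refinement fin step step-isDecEquivalence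

  -- `code` rounds an element of `D` to a representative and `point` reads it back. The round trip
  -- is correct only up to `R`, as equality on `D` may be undecidable.
  module Transfer {D′ : Set ℓ} {R : BinRel D ρ} (R-equiv : IsEquivalence R)
    (point : D′ → D) (code : D → D′) (point-code : ∀ d → R (point (code d)) d)
    where

    private module R = IsEquivalence R-equiv

    pullback : Model S D′
    pullback .funᴹ g v = code (funᴹ M g (Vec.map point v))
    pullback .relᴹ P v = relᴹ M P (Vec.map point v)

    infix 4 _∼_
    _∼_ : (ℕ → D′) → (ℕ → D) → Set ρ
    σ ∼ τ = ∀ n → R (point (σ n)) (τ n)

    ∼-· : ∀ {d′ d σ τ} → R (point d′) d → σ ∼ τ → _·_ {S = S} d′ σ ∼ _·_ {S = S} d τ
    ∼-· d′Rd σ∼τ zero    = d′Rd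
    ∼-· d′Rd σ∼τ (suc n) = σ∼τ n

    mutual
      eval-∼ : ∀ {σ τ} → σ ∼ τ → ∀ t → All (Congᶠ R) (funcsᵗ t) →
        R (point (eval pullback σ t)) (eval M τ t)
      eval-∼ σ∼τ (var n)    _        = σ∼τ n
      -- `pullback` rounds the value of `g` by `code`; `point-code` undoes this up to `R`, and
      -- congruence of `g` absorbs the errors in the arguments.
      eval-∼ σ∼τ (fun g ts) (c ∷ cs) = R.trans (point-code _) (c (evals-∼ σ∼τ ts cs))

      evals-∼ : ∀ {σ τ} → σ ∼ τ → ∀ {n} (ts : Vec (Term S) n) → All (Congᶠ R) (funcsᵗˢ ts) →
        Pointwise R (Vec.map point (evals pullback σ ts)) (evals M τ ts)
      evals-∼ σ∼τ []       _  = []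
      evals-∼ σ∼τ (t ∷ ts) cs =
        eval-∼ σ∼τ t (++⁻ˡ (funcsᵗ t) cs) ∷ evals-∼ σ∼τ ts (++⁻ʳ (funcsᵗ t) cs)

    -- Both directions are proved together because implication is contravariant, and for all related
    -- environments because quantifiers extend them.
    ⊨-∼ : ∀ φ → All (Congᶠ R) (funcs φ) → All (Congʳ R) (rels φ) → ∀ {σ τ} → σ ∼ τ →
      (pullback ⊨[ σ ] φ) ⇔ (M ⊨[ τ ] φ)
    ⊨-∼ ⊥̇           cf cr       σ∼τ = ⇔-id _
    ⊨-∼ (atom P ts) cf (c ∷ []) σ∼τ = c (evals-∼ σ∼τ ts cf)
    ⊨-∼ (φ →̇ ψ)     cf cr       σ∼τ = →-cong-⇔
      (⊨-∼ φ (++⁻ˡ (funcs φ) cf) (++⁻ˡ (rels φ) cr) σ∼τ)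
      (⊨-∼ ψ (++⁻ʳ (funcs φ) cf) (++⁻ʳ (rels φ) cr) σ∼τ)
    ⊨-∼ (φ ∧̇ ψ)     cf cr       σ∼τ =
      ⊨-∼ φ (++⁻ˡ (funcs φ) cf) (++⁻ˡ (rels φ) cr) σ∼τ ×-⇔
      ⊨-∼ ψ (++⁻ʳ (funcs φ) cf) (++⁻ʳ (rels φ) cr) σ∼τ
    ⊨-∼ (φ ∨̇ ψ)     cf cr       σ∼τ =
      ⊨-∼ φ (++⁻ˡ (funcs φ) cf) (++⁻ˡ (rels φ) cr) σ∼τ ⊎-⇔
      ⊨-∼ ψ (++⁻ʳ (funcs φ) cf) (++⁻ʳ (rels φ) cr) σ∼τ
    ⊨-∼ (∀̇ φ)       cf cr       σ∼τ = mk⇔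
      -- `d` need not be a value of `point`, so the hypothesis is used at `code d`, which stands for
      -- `d` up to `R`.
      (λ h d  → Equivalence.to   (⊨-∼ φ cf cr (∼-· (point-code d) σ∼τ)) (h (code d)))
      (λ h d′ → Equivalence.from (⊨-∼ φ cf cr (∼-· R.refl σ∼τ)) (h (point d′)))
    ⊨-∼ (∃̇ φ)       cf cr       σ∼τ = mk⇔
      (λ (d′ , h) → point d′ , Equivalence.to (⊨-∼ φ cf cr (∼-· R.refl σ∼τ)) h)
      (λ (d  , h) → code d , Equivalence.from (⊨-∼ φ cf cr (∼-· (point-code d) σ∼τ)) h)

-- Passing to the positions of the listing

Lift-Fin-finite : (n : ℕ) → Finite (Lift ℓ (Fin n))
Lift-Fin-finite n = map lift (allFin n) , λ (lift k) → [ ∈-map⁺ lift (∈-allFin k) ]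

Lift-Fin-discrete : (n : ℕ) → Discrete (Lift ℓ (Fin n))
Lift-Fin-discrete n (lift j) (lift k) = map′ (cong lift) (cong lower) (j Fin.≟ k)

module _ {D : Set a} {R : BinRel D ρ} (R-dec : IsDecEquivalence R) (fin : Finite D) where

  private
    module R = IsDecEquivalence R-dec
    xs = proj₁ fin

  -- The proof that `d` is listed is irrelevant and yields no position. Being `R`-related to `d` is
  -- decidable, so a search finds a position, and irrelevant membership guarantees its success by
  -- reflexivity.
  related∈ : ∀ d → Any (λ x → R x d) xs
  related∈ d = let [ d∈xs ] = proj₂ fin d in
    recompute (Any.any? (R._≟ d) xs) (Any.map (λ d≡x → R.reflexive (sym d≡x)) d∈xs)

FSAT⇒FSAT′ : (S : Signature f r) (φ : Formula S) → FSAT ℓ S φ → FSAT′ ℓ S φ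
FSAT⇒FSAT′ S φ (D , M , τ , fin@(xs , _) , M? , ⊨φ) =
  let R , R-dec , congᶠ , congʳ = decidableCongruence M fin M? (funcs φ) (rels φ)
      code d = lift (Any.index (related∈ R-dec fin d))
      point-code d = lookup-index (related∈ R-dec fin d)
      open Transfer M (IsDecEquivalence.isEquivalence R-dec) (lookup xs ∘ lower) code point-code
  in Lift _ (Fin (length xs)) , pullback , code ∘ τ
    , Lift-Fin-finite _ , Lift-Fin-discrete _ , (λ P v → M? P _)
    , Equivalence.from (⊨-∼ φ congᶠ congʳ (point-code ∘ τ)) ⊨φ

FSAT⇔FSAT′ : (S : Signature f r) (φ : Formula S) → FSAT ℓ S φ ⇔ FSAT′ ℓ S φ
FSAT⇔FSAT′ S φ = mk⇔ (FSAT⇒FSAT′ S φ) λ (D , M , ρ , fin , _ , M? , ⊨φ) → D , M , ρ , fin , M? , ⊨φ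

theorem20 : ∀ {f r : Level} (ℓ : Level) (S : Signature f r) →
    (∀ (φ : Formula S) → FSAT ℓ S φ ⇔ FSAT′ ℓ S φ)
    × (FSAT ℓ S ⪯ FSAT′ ℓ S)
    × (FSAT′ ℓ S ⪯ FSAT ℓ S)
theorem20 ℓ S =
  FSAT⇔FSAT′ S , (id , FSAT⇔FSAT′ S) , (id , λ φ → ⇔-sym (FSAT⇔FSAT′ S φ))
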